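{- Let $p>3$ be a prime. Then $$\sum_{k=0}^{[p/3]}\frac{\binom{3k}k}{27^k}\equiv\begin{cases}1\pmod p&\text{if }p\equiv\pm1\pmod 9,\\ -1\pmod p&\text{if }p\equiv\pm2\pmod9,\\ 0\pmod p&\text{if }p\equiv\pm4\pmod9.\end{cases}$$
   Context: $[x]$ is the greatest integer not exceeding $x$. -}

module Defs where

open import Data.Nat using (ℕ; zero; suc; _*_; _^_; NonZero)
open import Data.Nat.Properties using (m^n≢0)
open import Data.Nat.Combinatorics using (_C_)
open import Data.Integer using (ℤ; +_)
open import Data.Integer.Divisibility using () renaming (_∣_ to _∣ℤ_)
open import Data.Rational using (ℚ; _/_; _+_; _-_; ↥_; 0ℚ)

term : ℕ → ℚ
term k = _/_ (+ ((3 * k) C k)) (27 ^ k) {{m^n≢0 27 k}}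

S : ℕ → ℚ
S zero    = term zero
S (suc m) = S m + term (suc m)

-- Congruence of a rational number with an integer modulo a natural p:
-- x ≡ r (mod p) iff p divides the numerator of the reduced fraction x - r.
-- (For x with denominator coprime to p this is the usual p-adic congruence.)
_≡_[modℚ_] : ℚ → ℤ → ℕ → Set
x ≡ r [modℚ p ] = (+ p) ∣ℤ (↥ (x - (r / 1)))

{-# OPTIONS --safe #-}

-- Put n = [p/3].  Then p divides (3n+1)(3n+2), and comparing the ratios of
-- consecutive terms gives, for k ≤ n,
--   C(3k,k) / 27^k ≡ (-1)^k C(n+k,2k)  (mod p).
-- The integers b_n = Σ_{k≤n} (-1)^k C(n+k,2k) (Morgan-Voyce polynomials at -1)
-- satisfy b_{n+2} = b_{n+1} - b_n, hence b_{n+6} = b_n, so b_n depends only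
-- on p mod 18; as p is odd, only on p mod 9.
module Submission where

open import Defs
open import Data.Nat using (ℕ; _>_; _%_; _/_)
open import Data.Nat.Primality using (Prime)
open import Data.Integer using (+_; -_)
open import Data.Product using (_×_)
open import Data.Sum using (_⊎_)
open import Relation.Binary.PropositionalEquality using (_≡_)

open import Data.Nat as ℕ using (zero; suc; _≤_; _<_; s≤s; z≤n)
open import Data.Nat.Combinatorics using (_C_; nC1≡n; k>n⇒nCk≡0; nCk+nC[k+1]≡[n+1]C[k+1])
import Data.Nat.Divisibility as ℕ
import Data.Nat.DivMod as ℕ
import Data.Nat.Properties as ℕ
open import Data.Nat.Primality using (euclidsLemma; prime⇒irreducible; prime⇒nonTrivial)
open import Data.Nat.Tactic.RingSolver using () renaming (solve-∀ to solve-ℕ)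
open import Data.Integer using (ℤ; 0ℤ; -1ℤ; _+_; _*_; _-_; _^_; _≟_)
open import Data.Integer.Divisibility.Signed using (_∣_; divides; ∣ᵤ⇒∣; ∣⇒∣ᵤ; ∣m∣n⇒∣m+n; ∣n⇒∣m*n; ∣m⇒∣m*n)
open import Data.Integer.GCD using (gcd)
import Data.Integer.Properties as ℤ
open import Data.Integer.Tactic.RingSolver using (solve-∀)
open import Data.Rational as ℚ using (ℚ; ↥_; ↧_)
import Data.Rational.Properties as ℚ
open import Data.Product using (_,_; proj₁; proj₂)
open import Data.Sum using ([_,_]′)
open import Function using (_∘_)
open import Relation.Binary.PropositionalEquality using (_≢_; refl; sym; trans; cong; cong₂; subst; module ≡-Reasoning)
open import Relation.Nullary using (¬_; Dec; contradiction)
open import Relation.Nullary.Decidable using (from-yes; ¬?; _→-dec_; _×-dec_; _⊎-dec_)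

open ≡-Reasoning

-- Binomial coefficients

-- Induction on `m`: Pascal's rule splits the left binomial into `a` and `b`, and the hypotheses at
-- `k` and `suc k` treat the two pieces. The one copy of `a` left over raises the factor `suc m` to
-- `suc (suc m)`.
absorption : ∀ m k → suc k ℕ.* (suc m C suc k) ≡ suc m ℕ.* (m C k)
absorption zero zero = refl
absorption zero (suc k) = begin
  suc (suc k) ℕ.* (1 C suc (suc k)) ≡⟨ cong (suc (suc k) ℕ.*_) (k>n⇒nCk≡0 (s≤s (s≤s (z≤n {k})))) ⟩
  suc (suc k) ℕ.* 0                 ≡⟨ ℕ.*-zeroʳ (suc (suc k)) ⟩
  0                                 ≡⟨ cong (1 ℕ.*_) (k>n⇒nCk≡0 (s≤s (z≤n {k}))) ⟨
  1 ℕ.* (0 C suc k)                 ∎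
absorption (suc m) zero = begin
  1 ℕ.* (suc (suc m) C 1)       ≡⟨ cong (1 ℕ.*_) (nC1≡n (suc (suc m))) ⟩
  1 ℕ.* suc (suc m)             ≡⟨ ℕ.*-comm 1 (suc (suc m)) ⟩
  suc (suc m) ℕ.* 1             ∎
absorption (suc m) (suc k) = begin
  suc (suc k) ℕ.* (suc (suc m) C suc (suc k))
    ≡⟨ cong (suc (suc k) ℕ.*_) (nCk+nC[k+1]≡[n+1]C[k+1] (suc m) (suc k)) ⟨
  suc (suc k) ℕ.* (a ℕ.+ b)
    ≡⟨ expand k a b ⟩
  suc k ℕ.* a ℕ.+ (a ℕ.+ suc (suc k) ℕ.* b)
    ≡⟨ cong₂ (λ u v → u ℕ.+ (a ℕ.+ v)) (absorption m k) (absorption m (suc k)) ⟩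
  suc m ℕ.* (m C k) ℕ.+ (a ℕ.+ suc m ℕ.* (m C suc k))
    ≡⟨ collect m (m C k) (m C suc k) a ⟩
  a ℕ.+ suc m ℕ.* (m C k ℕ.+ m C suc k)
    ≡⟨ cong (λ u → a ℕ.+ suc m ℕ.* u) (nCk+nC[k+1]≡[n+1]C[k+1] m k) ⟩
  suc (suc m) ℕ.* a ∎
  where
  a = suc m C suc k
  b = suc m C suc (suc k)
  expand : ∀ k a b → suc (suc k) ℕ.* (a ℕ.+ b) ≡ suc k ℕ.* a ℕ.+ (a ℕ.+ suc (suc k) ℕ.* b)
  expand = solve-ℕ
  collect : ∀ m x y a → suc m ℕ.* x ℕ.+ (a ℕ.+ suc m ℕ.* y) ≡ a ℕ.+ suc m ℕ.* (x ℕ.+ y)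
  collect = solve-ℕ

-- The upper index is written `k + j` so that the factor `j` needs no subtraction. Adding `suc k`
-- times the binomial on the right to both sides reduces this, by Pascal's rule, to `absorption`.
C-suc-lower : ∀ k j → suc k ℕ.* ((k ℕ.+ j) C suc k) ≡ j ℕ.* ((k ℕ.+ j) C k)
C-suc-lower k j = ℕ.+-cancelˡ-≡ (suc k ℕ.* a) _ _ (begin
  suc k ℕ.* a ℕ.+ suc k ℕ.* b ≡⟨ ℕ.*-distribˡ-+ (suc k) a b ⟨
  suc k ℕ.* (a ℕ.+ b)         ≡⟨ cong (suc k ℕ.*_) (nCk+nC[k+1]≡[n+1]C[k+1] (k ℕ.+ j) k) ⟩
  suc k ℕ.* (suc (k ℕ.+ j) C suc k) ≡⟨ absorption (k ℕ.+ j) k ⟩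
  suc (k ℕ.+ j) ℕ.* a         ≡⟨ ℕ.*-distribʳ-+ a (suc k) j ⟩
  suc k ℕ.* a ℕ.+ j ℕ.* a     ∎)
  where
  a = (k ℕ.+ j) C k
  b = (k ℕ.+ j) C suc k

C-suc-upper : ∀ k j → suc j ℕ.* (suc (k ℕ.+ j) C k) ≡ suc (k ℕ.+ j) ℕ.* ((k ℕ.+ j) C k)
C-suc-upper zero    j = refl
C-suc-upper (suc k) j = begin
  suc j ℕ.* (suc m C suc k)             ≡⟨ cong (suc j ℕ.*_) (nCk+nC[k+1]≡[n+1]C[k+1] m k) ⟨
  suc j ℕ.* (m C k ℕ.+ m C suc k)       ≡⟨ ℕ.*-distribˡ-+ (suc j) (m C k) (m C suc k) ⟩
  suc j ℕ.* (m C k) ℕ.+ suc j ℕ.* (m C suc k)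
    ≡⟨ cong (ℕ._+ suc j ℕ.* (m C suc k)) lower ⟨
  suc k ℕ.* (m C suc k) ℕ.+ suc j ℕ.* (m C suc k)
    ≡⟨ ℕ.*-distribʳ-+ (m C suc k) (suc k) (suc j) ⟨
  (suc k ℕ.+ suc j) ℕ.* (m C suc k)     ≡⟨ cong (ℕ._* (m C suc k)) (ℕ.+-suc (suc k) j) ⟩
  suc m ℕ.* (m C suc k)                 ∎
  where
  m = suc k ℕ.+ j
  lower : suc k ℕ.* (m C suc k) ≡ suc j ℕ.* (m C k)
  lower = subst (λ m → suc k ℕ.* (m C suc k) ≡ suc j ℕ.* (m C k)) (ℕ.+-suc k j) (C-suc-lower k (suc j))

-- The ratio of consecutive central terms, cleared of denominators. One absorption lowers both
-- indices, and two uses of `C-suc-upper` bring the upper index down to 3k. The factor 3k+3 that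
-- appears is 3(k+1), so the auxiliary multiplier `suc k` cancels.
[3k]Ck-suc : ∀ k → (1 ℕ.+ 2 ℕ.* k) ℕ.* (2 ℕ.+ 2 ℕ.* k) ℕ.* ((3 ℕ.* suc k) C suc k)
                 ≡ 3 ℕ.* ((1 ℕ.+ 3 ℕ.* k) ℕ.* (2 ℕ.+ 3 ℕ.* k)) ℕ.* ((3 ℕ.* k) C k)
[3k]Ck-suc k = ℕ.*-cancelˡ-≡ _ _ (suc k) (begin
  suc k ℕ.* (u ℕ.* v ℕ.* ((3 ℕ.* suc k) C suc k))
    ≡⟨ cong (λ m → suc k ℕ.* (u ℕ.* v ℕ.* (m C suc k))) (three-suc k) ⟩
  suc k ℕ.* (u ℕ.* v ℕ.* (suc (2 ℕ.+ m) C suc k))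
    ≡⟨ rot (suc k) u v (suc (2 ℕ.+ m) C suc k) ⟩
  u ℕ.* (v ℕ.* (suc k ℕ.* (suc (2 ℕ.+ m) C suc k)))
    ≡⟨ cong (λ x → u ℕ.* (v ℕ.* x)) (absorption (2 ℕ.+ m) k) ⟩
  u ℕ.* (v ℕ.* ((3 ℕ.+ m) ℕ.* ((2 ℕ.+ m) C k)))
    ≡⟨ rot′ u v (3 ℕ.+ m) ((2 ℕ.+ m) C k) ⟩
  u ℕ.* ((3 ℕ.+ m) ℕ.* (v ℕ.* ((2 ℕ.+ m) C k)))
    ≡⟨ cong (λ x → u ℕ.* ((3 ℕ.+ m) ℕ.* x)) upper₂ ⟩
  u ℕ.* ((3 ℕ.+ m) ℕ.* ((2 ℕ.+ m) ℕ.* ((1 ℕ.+ m) C k)))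
    ≡⟨ rot″ u (3 ℕ.+ m) (2 ℕ.+ m) ((1 ℕ.+ m) C k) ⟩
  (3 ℕ.+ m) ℕ.* ((2 ℕ.+ m) ℕ.* (u ℕ.* ((1 ℕ.+ m) C k)))
    ≡⟨ cong (λ x → (3 ℕ.+ m) ℕ.* ((2 ℕ.+ m) ℕ.* x)) upper₁ ⟩
  (3 ℕ.+ m) ℕ.* ((2 ℕ.+ m) ℕ.* ((1 ℕ.+ m) ℕ.* (m C k)))
    ≡⟨ finish k (m C k) ⟩
  suc k ℕ.* (3 ℕ.* ((1 ℕ.+ m) ℕ.* (2 ℕ.+ m)) ℕ.* (m C k)) ∎)
  where
  m = 3 ℕ.* k
  u = 1 ℕ.+ 2 ℕ.* k
  v = 2 ℕ.+ 2 ℕ.* k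
  three-suc : ∀ k → 3 ℕ.* suc k ≡ 3 ℕ.+ 3 ℕ.* k
  three-suc = solve-ℕ
  rot : ∀ a u v x → a ℕ.* (u ℕ.* v ℕ.* x) ≡ u ℕ.* (v ℕ.* (a ℕ.* x))
  rot = solve-ℕ
  rot′ : ∀ u v w x → u ℕ.* (v ℕ.* (w ℕ.* x)) ≡ u ℕ.* (w ℕ.* (v ℕ.* x))
  rot′ = solve-ℕ
  rot″ : ∀ u v w x → u ℕ.* (v ℕ.* (w ℕ.* x)) ≡ v ℕ.* (w ℕ.* (u ℕ.* x))
  rot″ = solve-ℕ
  finish : ∀ k x → (3 ℕ.+ 3 ℕ.* k) ℕ.* ((2 ℕ.+ 3 ℕ.* k) ℕ.* ((1 ℕ.+ 3 ℕ.* k) ℕ.* x))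
                 ≡ suc k ℕ.* (3 ℕ.* ((1 ℕ.+ 3 ℕ.* k) ℕ.* (2 ℕ.+ 3 ℕ.* k)) ℕ.* x)
  finish = solve-ℕ
  upper₁ : u ℕ.* ((1 ℕ.+ m) C k) ≡ (1 ℕ.+ m) ℕ.* (m C k)
  upper₁ = C-suc-upper k (2 ℕ.* k)
  upper₂ : v ℕ.* ((2 ℕ.+ m) C k) ≡ (2 ℕ.+ m) ℕ.* ((1 ℕ.+ m) C k)
  upper₂ = subst (λ m → v ℕ.* (suc m C k) ≡ suc m ℕ.* (m C k)) (ℕ.+-suc k (2 ℕ.* k)) (C-suc-upper k u)

-- The matching ratio for the Morgan-Voyce coefficients, with `j` in the role of n - k: absorption
-- removes the factor 2k+2, then `C-suc-lower` removes 2k+1.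
[n+k]C[2k]-suc : ∀ k j → let n = k ℕ.+ j in
  (1 ℕ.+ 2 ℕ.* k) ℕ.* (2 ℕ.+ 2 ℕ.* k) ℕ.* ((n ℕ.+ suc k) C (2 ℕ.* suc k))
    ≡ (1 ℕ.+ n ℕ.+ k) ℕ.* j ℕ.* ((n ℕ.+ k) C (2 ℕ.* k))
[n+k]C[2k]-suc k j = begin
  u ℕ.* v ℕ.* ((k ℕ.+ j ℕ.+ suc k) C (2 ℕ.* suc k))
    ≡⟨ cong₂ (λ x y → u ℕ.* v ℕ.* (x C y)) (top k j) (bottom k) ⟩
  u ℕ.* v ℕ.* (suc m C v)
    ≡⟨ ℕ.*-assoc u v (suc m C v) ⟩
  u ℕ.* (v ℕ.* (suc m C v))
    ≡⟨ cong (u ℕ.*_) (absorption m u) ⟩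
  u ℕ.* (suc m ℕ.* (m C u))
    ≡⟨ swap u (suc m) _ ⟩
  suc m ℕ.* (u ℕ.* (m C u))
    ≡⟨ cong (suc m ℕ.*_) (C-suc-lower (2 ℕ.* k) j) ⟩
  suc m ℕ.* (j ℕ.* (m C (2 ℕ.* k)))
    ≡⟨ ℕ.*-assoc (suc m) j _ ⟨
  suc m ℕ.* j ℕ.* (m C (2 ℕ.* k))
    ≡⟨ cong (λ m → suc m ℕ.* j ℕ.* (m C (2 ℕ.* k))) (back k j) ⟩
  (1 ℕ.+ (k ℕ.+ j) ℕ.+ k) ℕ.* j ℕ.* ((k ℕ.+ j ℕ.+ k) C (2 ℕ.* k)) ∎
  where
  m = 2 ℕ.* k ℕ.+ j
  u = 1 ℕ.+ 2 ℕ.* k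
  v = 2 ℕ.+ 2 ℕ.* k
  top : ∀ k j → k ℕ.+ j ℕ.+ suc k ≡ suc (2 ℕ.* k ℕ.+ j)
  top = solve-ℕ
  bottom : ∀ k → 2 ℕ.* suc k ≡ 2 ℕ.+ 2 ℕ.* k
  bottom = solve-ℕ
  back : ∀ k j → 2 ℕ.* k ℕ.+ j ≡ k ℕ.+ j ℕ.+ k
  back = solve-ℕ
  swap : ∀ u v x → u ℕ.* (v ℕ.* x) ≡ v ℕ.* (u ℕ.* x)
  swap = solve-ℕ

-- Morgan-Voyce sums at -1

Σ≤ : (ℕ → ℤ) → ℕ → ℤ
Σ≤ f zero    = f zero
Σ≤ f (suc m) = Σ≤ f m + f (suc m)

-- The summands of the two Morgan-Voyce families at -1. The companion `γ` enters because Pascal's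
-- rule mixes even and odd lower indices.
β γ : ℕ → ℕ → ℤ
β n k = -1ℤ ^ k * + ((n ℕ.+ k) C (2 ℕ.* k))
γ n k = -1ℤ ^ k * + (suc (n ℕ.+ k) C suc (2 ℕ.* k))

γ-suc : ∀ n k → γ (suc n) k ≡ β (suc n) k + γ n k
γ-suc n k = begin
  e * + (suc (suc n ℕ.+ k) C suc (2 ℕ.* k))
    ≡⟨ cong (λ x → e * + x) (nCk+nC[k+1]≡[n+1]C[k+1] (suc n ℕ.+ k) (2 ℕ.* k)) ⟨
  e * (+ ((suc n ℕ.+ k) C (2 ℕ.* k)) + + ((suc n ℕ.+ k) C suc (2 ℕ.* k)))
    ≡⟨ ℤ.*-distribˡ-+ e _ _ ⟩
  β (suc n) k + γ n k ∎
  where e = -1ℤ ^ k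

β-suc : ∀ n k → β (suc n) (suc k) ≡ β n (suc k) - γ n k
β-suc n k rewrite ℕ.+-suc n k | ℕ.+-suc k (k ℕ.+ 0) = begin
  -1ℤ * e * + (suc (suc (n ℕ.+ k)) C suc (suc (2 ℕ.* k)))
    ≡⟨ cong (λ x → -1ℤ * e * + x) (nCk+nC[k+1]≡[n+1]C[k+1] (suc (n ℕ.+ k)) (suc (2 ℕ.* k))) ⟨
  -1ℤ * e * (+ x + + y)
    ≡⟨ expand e (+ x) (+ y) ⟩
  -1ℤ * e * + y - e * + x ∎
  where
  e = -1ℤ ^ k
  x = suc (n ℕ.+ k) C suc (2 ℕ.* k)
  y = suc (n ℕ.+ k) C suc (suc (2 ℕ.* k))
  expand : ∀ e x y → -1ℤ * e * (x + y) ≡ -1ℤ * e * y - e * x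
  expand = solve-∀

-- The lower index 2n+2 exceeds the upper index 2n+1. This vanishing, with its analogue for `γ`,
-- lets a sum up to `suc n` be cut back to `n`.
β-diagonal : ∀ n → β n (suc n) ≡ 0ℤ
β-diagonal n = trans (cong (λ x → -1ℤ ^ suc n * + x) (k>n⇒nCk≡0 lt)) (ℤ.*-zeroʳ (-1ℤ ^ suc n))
  where
  eq : ∀ n → 2 ℕ.* suc n ≡ suc (n ℕ.+ suc n)
  eq = solve-ℕ
  lt : n ℕ.+ suc n < 2 ℕ.* suc n
  lt = ℕ.≤-reflexive (sym (eq n))

γ-diagonal : ∀ n → γ n (suc n) ≡ 0ℤ
γ-diagonal n = trans (cong (λ x → -1ℤ ^ suc n * + x) (k>n⇒nCk≡0 lt)) (ℤ.*-zeroʳ (-1ℤ ^ suc n))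
  where
  eq : ∀ n → suc (2 ℕ.* suc n) ≡ suc (suc (n ℕ.+ suc n))
  eq = solve-ℕ
  lt : suc (n ℕ.+ suc n) < suc (2 ℕ.* suc n)
  lt = ℕ.≤-reflexive (sym (eq n))

Σγ-suc : ∀ n m → Σ≤ (γ (suc n)) m ≡ Σ≤ (β (suc n)) m + Σ≤ (γ n) m
Σγ-suc n zero    = γ-suc n zero
Σγ-suc n (suc m) = trans (cong₂ _+_ (Σγ-suc n m) (γ-suc n (suc m)))
                         (interchange (Σ≤ (β (suc n)) m) (Σ≤ (γ n) m) (β (suc n) (suc m)) (γ n (suc m)))
  where
  interchange : ∀ a b c d → a + b + (c + d) ≡ a + c + (b + d)
  interchange = solve-∀

Σβ-suc : ∀ n m → Σ≤ (β (suc n)) (suc m) ≡ Σ≤ (β n) (suc m) - Σ≤ (γ n) m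
-- The summands at k = 0 are both 1 by computation, so `β n 0` may stand for `β (suc n) 0`.
Σβ-suc n zero    = trans (cong (_+_ (β (suc n) 0)) (β-suc n zero)) (assoc (β n 0) (β n 1) (γ n 0))
  where
  assoc : ∀ a b c → a + (b - c) ≡ a + b - c
  assoc = solve-∀
Σβ-suc n (suc m) = trans (cong₂ _+_ (Σβ-suc n m) (β-suc n (suc m)))
                         (interchange (Σ≤ (β n) (suc m)) (Σ≤ (γ n) m) (β n (suc (suc m))) (γ n (suc m)))
  where
  interchange : ∀ a b c d → a - b + (c - d) ≡ a + c - (b + d)
  interchange = solve-∀

b B : ℕ → ℤ
b n = Σ≤ (β n) n
B n = Σ≤ (γ n) n

b-suc : ∀ n → b (suc n) ≡ b n - B n
b-suc n = begin
  b (suc n)                 ≡⟨ Σβ-suc n n ⟩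
  b n + β n (suc n) - B n   ≡⟨ cong (λ x → b n + x - B n) (β-diagonal n) ⟩
  b n + 0ℤ - B n            ≡⟨ cong (_- B n) (ℤ.+-identityʳ (b n)) ⟩
  b n - B n                 ∎

-- Pascal's rule gives `b (suc n) + B n`; at the argument -1, `b-suc` makes the two copies of `B n`
-- cancel.
B-suc : ∀ n → B (suc n) ≡ b n
B-suc n = begin
  B (suc n)                       ≡⟨ Σγ-suc n (suc n) ⟩
  b (suc n) + (B n + γ n (suc n)) ≡⟨ cong₂ (λ x y → x + (B n + y)) (b-suc n) (γ-diagonal n) ⟩
  b n - B n + (B n + 0ℤ)          ≡⟨ cancel (b n) (B n) ⟩
  b n                             ∎
  where
  cancel : ∀ x y → x - y + (y + 0ℤ) ≡ x
  cancel = solve-∀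

-- Periodicity and values of `b`

b-suc-suc : ∀ n → b (2 ℕ.+ n) ≡ b (1 ℕ.+ n) - b n
b-suc-suc n = trans (b-suc (suc n)) (cong (_-_ (b (suc n))) (B-suc n))

-- The characteristic polynomial x² - x + 1 of the recurrence divides x³ + 1, so three steps change
-- the sign.
b-antiperiodic : ∀ n → b (3 ℕ.+ n) ≡ - b n
b-antiperiodic n = begin
  b (3 ℕ.+ n)                       ≡⟨ b-suc-suc (suc n) ⟩
  b (2 ℕ.+ n) - b (1 ℕ.+ n)         ≡⟨ cong (_- b (1 ℕ.+ n)) (b-suc-suc n) ⟩
  b (1 ℕ.+ n) - b n - b (1 ℕ.+ n)   ≡⟨ cancel (b (1 ℕ.+ n)) (b n) ⟩
  - b n                             ∎
  where
  cancel : ∀ x y → x - y - x ≡ - y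
  cancel = solve-∀

b-periodic : ∀ q n → b (n ℕ.+ q ℕ.* 6) ≡ b n
b-periodic zero    n = cong b (ℕ.+-identityʳ n)
b-periodic (suc q) n = begin
  b (n ℕ.+ (6 ℕ.+ q ℕ.* 6)) ≡⟨ cong b (shift n (q ℕ.* 6)) ⟩
  b (6 ℕ.+ m)               ≡⟨ b-antiperiodic (3 ℕ.+ m) ⟩
  - b (3 ℕ.+ m)             ≡⟨ cong -_ (b-antiperiodic m) ⟩
  - - b m                   ≡⟨ ℤ.neg-involutive (b m) ⟩
  b m                       ≡⟨ b-periodic q n ⟩
  b n                       ∎
  where
  m = n ℕ.+ q ℕ.* 6
  shift : ∀ n r → n ℕ.+ (6 ℕ.+ r) ≡ 6 ℕ.+ (n ℕ.+ r)
  shift = solve-ℕ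

-- Adding 18 to `p` adds 6 to `p / 3`, which is a full period of `b`.
b-[p/3] : ∀ p → b (p / 3) ≡ b (p % 18 / 3)
b-[p/3] p = begin
  b (p / 3)                          ≡⟨ cong (λ m → b (m / 3)) (ℕ.m≡m%n+[m/n]*n p 18) ⟩
  b ((p % 18 ℕ.+ q ℕ.* 18) / 3)      ≡⟨ cong b (ℕ.+-distrib-/-∣ʳ (p % 18) (ℕ.divides (q ℕ.* 6) (eq q))) ⟩
  b (p % 18 / 3 ℕ.+ q ℕ.* 18 / 3)    ≡⟨ cong (λ m → b (p % 18 / 3 ℕ.+ m)) (trans (cong (_/ 3) (eq q)) (ℕ.m*n/n≡m (q ℕ.* 6) 3)) ⟩
  b (p % 18 / 3 ℕ.+ q ℕ.* 6)         ≡⟨ b-periodic q (p % 18 / 3) ⟩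
  b (p % 18 / 3)                     ∎
  where
  q = p / 18
  eq : ∀ q → q ℕ.* 18 ≡ q ℕ.* 6 ℕ.* 3
  eq = solve-ℕ

-- Here `t` is meant as a residue modulo 18 and `r` as the one modulo 9. They are separate
-- parameters so that `r` can later be rewritten from `p % 18 % 9` to `p % 9` with `t` unchanged.
Table : ℕ → ℕ → Set
Table t r = ((r ≡ 1 ⊎ r ≡ 8) → b (t / 3) ≡ + 1)
  × ((r ≡ 2 ⊎ r ≡ 7) → b (t / 3) ≡ - (+ 1))
  × ((r ≡ 4 ⊎ r ≡ 5) → b (t / 3) ≡ + 0)

table? : ∀ t r → Dec (Table t r)
table? t r = (((r ℕ.≟ 1) ⊎-dec (r ℕ.≟ 8)) →-dec (b (t / 3) ≟ + 1))
  ×-dec (((r ℕ.≟ 2) ⊎-dec (r ℕ.≟ 7)) →-dec (b (t / 3) ≟ - (+ 1)))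
  ×-dec (((r ℕ.≟ 4) ⊎-dec (r ℕ.≟ 5)) →-dec (b (t / 3) ≟ + 0))

-- A finite check by decision. Oddness matters: 1 and 10 agree modulo 9, but `b 0` is 1 while `b 3`
-- is -1.
b-table : ∀ {t} → t < 18 → t % 2 ≢ 0 → Table t (t % 9)
b-table = from-yes (ℕ.allUpTo? (λ t → ¬? (t % 2 ℕ.≟ 0) →-dec table? t (t % 9)) 18)

-- Congruences of rationals modulo a prime

module _ {p : ℕ} (p-prime : Prime p) where

  ∣*⇒∣ : ∀ i j → ¬ + p ∣ i → + p ∣ i * j → + p ∣ j
  ∣*⇒∣ i j p∤i p∣ij = [ (λ p∣i → contradiction (∣ᵤ⇒∣ p∣i) p∤i) , ∣ᵤ⇒∣ ]′
    (euclidsLemma _ _ p-prime (subst (p ℕ.∣_) (ℤ.abs-* i j) (∣⇒∣ᵤ p∣ij)))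

  ∤* : ∀ {i j} → ¬ + p ∣ i → ¬ + p ∣ j → ¬ + p ∣ i * j
  ∤* p∤i p∤j = p∤j ∘ ∣*⇒∣ _ _ p∤i

  ∤-pos : ∀ {m} → ¬ p ℕ.∣ m → ¬ + p ∣ + m
  ∤-pos p∤m = p∤m ∘ ∣⇒∣ᵤ

  -- Congruence modulo p in the local ring ℤ₍ₚ₎.
  _∼_ : ℚ → ℤ → Set
  x ∼ a = ¬ + p ∣ ↧ x × + p ∣ ↥ x - a * ↧ x

  -- Reducing the fraction divides `i` and `n` by their gcd `g`. As `g` divides `n`, it is prime to
  -- `p` and can be cancelled from `i - a * n`.
  /-∼ : ∀ i n .{{_ : ℕ.NonZero n}} a → ¬ + p ∣ + n → + p ∣ i - a * + n → (i ℚ./ n) ∼ a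
  /-∼ i n a p∤n p∣i-an = p∤↧ , ∣*⇒∣ g _ p∤g (subst (+ p ∣_) eq p∣i-an)
    where
    g = gcd i (+ n)
    x = i ℚ./ n
    p∤↧ : ¬ + p ∣ ↧ x
    p∤↧ d = p∤n (subst (+ p ∣_) (ℚ.↧-/ i n) (∣m⇒∣m*n g d))
    p∤g : ¬ + p ∣ g
    p∤g d = p∤n (subst (+ p ∣_) (ℚ.↧-/ i n) (∣n⇒∣m*n (↧ x) d))
    factor : ∀ u d g a → u * g - a * (d * g) ≡ g * (u - a * d)
    factor = solve-∀
    eq : i - a * + n ≡ g * (↥ x - a * ↧ x)
    eq = trans (sym (cong₂ (λ u v → u - a * v) (ℚ.↥-/ i n) (ℚ.↧-/ i n))) (factor (↥ x) (↧ x) g a)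

  +-∼ : ∀ x y a c → x ∼ a → y ∼ c → (x ℚ.+ y) ∼ (a + c)
  -- The record patterns make the sum unfold to an unreduced quotient, to which `/-∼` applies.
  +-∼ x@record{} y@record{} a c (p∤↧x , p∣x-a) (p∤↧y , p∣y-c) =
    /-∼ (↥ x * ↧ y + ↥ y * ↧ x) (ℚ.↧ₙ x ℕ.* ℚ.↧ₙ y) (a + c)
      (subst (λ d → ¬ + p ∣ d) (sym pos) (∤* p∤↧x p∤↧y))
      (subst (+ p ∣_) (sym (trans (cong (λ d → ↥ x * ↧ y + ↥ y * ↧ x - (a + c) * d) pos)
                                  (split (↥ x) (↧ x) (↥ y) (↧ y) a c)))
        (∣m∣n⇒∣m+n (∣n⇒∣m*n (↧ y) p∣x-a) (∣n⇒∣m*n (↧ x) p∣y-c)))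
    where
    pos : + (ℚ.↧ₙ x ℕ.* ℚ.↧ₙ y) ≡ ↧ x * ↧ y
    pos = ℤ.pos-* (ℚ.↧ₙ x) (ℚ.↧ₙ y)
    split : ∀ u d v e a c → u * e + v * d - (a + c) * (d * e) ≡ e * (u - a * d) + d * (v - c * e)
    split = solve-∀

  neg-∼ : ∀ x a → x ∼ a → (ℚ.- x) ∼ (- a)
  neg-∼ x a (p∤↧x , p∣x-a) =
    subst (λ d → ¬ + p ∣ d) (sym (ℚ.↧-neg x)) p∤↧x ,
    subst (+ p ∣_) (sym (trans (cong₂ (λ u d → u - - a * d) (ℚ.↥-neg x) (ℚ.↧-neg x)) (flip (↥ x) (↧ x) a)))
      (∣n⇒∣m*n -1ℤ p∣x-a)
    where
    flip : ∀ u d a → - u - - a * d ≡ -1ℤ * (u - a * d)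
    flip = solve-∀

  -- The difference `y` is congruent to `r - r`, so the term subtracted from its numerator vanishes
  -- and `p` divides the numerator itself.
  ∼⇒≡mod : ∀ x r → x ∼ r → x ≡ r [modℚ p ]
  ∼⇒≡mod x r x∼r = ∣⇒∣ᵤ (subst (+ p ∣_) (drop r (↥ y) (↧ y)) (proj₂ y∼))
    where
    y = x ℚ.- (r ℚ./ 1)
    p∤1 : ¬ p ℕ.∣ 1
    p∤1 d = contradiction (ℕ.∣1⇒≡1 d) (ℕ.nonTrivial⇒≢1 {{prime⇒nonTrivial p-prime}})
    self : ∀ r → 0ℤ ≡ r - r * + 1
    self = solve-∀
    y∼ : y ∼ (r - r)
    y∼ = +-∼ x (ℚ.- (r ℚ./ 1)) r (- r) x∼r
      (neg-∼ (r ℚ./ 1) r (/-∼ r 1 r (∤-pos p∤1) (subst (+ p ∣_) (self r) (divides 0ℤ refl))))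
    drop : ∀ r u d → u - (r - r) * d ≡ u
    drop = solve-∀

  -- Comparison of the terms modulo `p`

  module _ (p>3 : p > 3) where

    private n = p / 3

    ∤small : ∀ {d} .{{_ : ℕ.NonZero d}} → d < p → ¬ p ℕ.∣ d
    ∤small d<p p∣d = ℕ.<⇒≱ d<p (ℕ.∣⇒≤ p∣d)

    small∤ : ∀ {d} → d ≢ 1 → d < p → ¬ d ℕ.∣ p
    small∤ d≢1 d<p d∣p = [ d≢1 , ℕ.<⇒≢ d<p ]′ (prime⇒irreducible p-prime d∣p)

    p∤27^ : ∀ k → ¬ + p ∣ + (27 ℕ.^ k)
    p∤27^ zero    = ∤-pos (∤small (ℕ.<-trans (s≤s (s≤s z≤n)) p>3))
    p∤27^ (suc k) = subst (λ i → ¬ + p ∣ i) (sym (ℤ.pos-* 27 (27 ℕ.^ k)))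
                      -- Since `p` may be below 27, a size bound settles only 3; hence 27 is split
                      -- into factors 3.
                      (∤* {+ 27} (∤* {+ 3} {+ 9} p∤3 (∤* {+ 3} {+ 3} p∤3 p∤3)) (p∤27^ k))
      where
      p∤3 : ¬ + p ∣ + 3
      p∤3 = ∤-pos (∤small p>3)

    -- Since 3 does not divide `p`, the remainder of `p` modulo 3 is 1 or 2, and one of the two
    -- factors is `p` itself.
    p∣[3n+1][3n+2] : + p ∣ (+ 1 + + 3 * + n) * (+ 2 + + 3 * + n)
    p∣[3n+1][3n+2] = residue (p % 3) refl (ℕ.m%n<n p 3)
      where
      p∣r+3n : ∀ r → p % 3 ≡ r → + p ∣ + r + + 3 * + n
      p∣r+3n r e = subst (+ p ∣_)
        (trans (cong +_ (trans (ℕ.m≡m%n+[m/n]*n p 3) (cong₂ ℕ._+_ e (ℕ.*-comm n 3))))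
               (cong (_+_ (+ r)) (ℤ.pos-* 3 n)))
        (∣ᵤ⇒∣ ℕ.∣-refl)
      residue : ∀ r → p % 3 ≡ r → r < 3 → + p ∣ (+ 1 + + 3 * + n) * (+ 2 + + 3 * + n)
      residue 0 e _ = contradiction (ℕ.m%n≡0⇒n∣m p 3 e) (small∤ (λ ()) p>3)
      residue 1 e _ = ∣m⇒∣m*n (+ 2 + + 3 * + n) (p∣r+3n 1 e)
      residue 2 e _ = ∣n⇒∣m*n (+ 1 + + 3 * + n) (p∣r+3n 2 e)
      residue (suc (suc (suc _))) _ (s≤s (s≤s (s≤s ())))

    2n<p : 0 < n → 2 ℕ.* n < p
    2n<p 0<n = ℕ.<-≤-trans (ℕ.*-monoˡ-< n {{ℕ.>-nonZero 0<n}} (ℕ.n<1+n 2))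
                           (subst (_≤ p) (ℕ.*-comm n 3) (ℕ.m/n*n≤m p 3))

    -- Induction on `k`, after multiplying by `M` = (2k+1)(2k+2). The two recurrences then have the
    -- factors 3(3k+1)(3k+2) and -27(n+k+1)(n-k), which differ by 3(3n+1)(3n+2), a multiple of `p`.
    -- The bound by `n` keeps both factors of `M` below `p`, so `M` can be cancelled.
    [3k]Ck≡27^k*β : ∀ k → k ≤ n → + p ∣ + ((3 ℕ.* k) C k) - β n k * + (27 ℕ.^ k)
    [3k]Ck≡27^k*β zero    _   = divides 0ℤ refl
    [3k]Ck≡27^k*β (suc k) k<n = ∣*⇒∣ M _ p∤M (subst (+ p ∣_) (sym eq)
        (∣m∣n⇒∣m+n (∣n⇒∣m*n (+ 3 * ((+ 1 + + 3 * + k) * (+ 2 + + 3 * + k))) ([3k]Ck≡27^k*β k (ℕ.<⇒≤ k<n)))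
                    (∣n⇒∣m*n (+ 3 * (e * + w) * + d) p∣[3n+1][3n+2])))
      where
      j = n ℕ.∸ k
      k+j≡n : k ℕ.+ j ≡ n
      k+j≡n = ℕ.m+[n∸m]≡n (ℕ.<⇒≤ k<n)
      M = + (1 ℕ.+ 2 ℕ.* k) * + (2 ℕ.+ 2 ℕ.* k)
      c  = (3 ℕ.* k) C k
      c′ = (3 ℕ.* suc k) C suc k
      d  = (n ℕ.+ k) C (2 ℕ.* k)
      d′ = (n ℕ.+ suc k) C (2 ℕ.* suc k)
      e = -1ℤ ^ k
      w = 27 ℕ.^ k
      2+2k<p : 2 ℕ.+ 2 ℕ.* k < p
      2+2k<p = ℕ.≤-<-trans (subst (_≤ 2 ℕ.* n) (ℕ.*-suc 2 k) (ℕ.*-monoʳ-≤ 2 k<n))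
                           (2n<p (ℕ.≤-<-trans z≤n k<n))
      p∤M : ¬ + p ∣ M
      p∤M = ∤* (∤-pos (∤small (ℕ.<-trans (ℕ.n<1+n _) 2+2k<p))) (∤-pos (∤small 2+2k<p))
      pos-*-* : ∀ x y z → + (x ℕ.* y ℕ.* z) ≡ + x * + y * + z
      pos-*-* x y z = trans (ℤ.pos-* (x ℕ.* y) z) (cong (_* + z) (ℤ.pos-* x y))
      Mc′ : M * + c′ ≡ + 3 * ((+ 1 + + 3 * + k) * (+ 2 + + 3 * + k)) * + c
      Mc′ = begin
        M * + c′
          ≡⟨ pos-*-* (1 ℕ.+ 2 ℕ.* k) (2 ℕ.+ 2 ℕ.* k) c′ ⟨
        + ((1 ℕ.+ 2 ℕ.* k) ℕ.* (2 ℕ.+ 2 ℕ.* k) ℕ.* c′)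
          ≡⟨ cong +_ ([3k]Ck-suc k) ⟩
        + (3 ℕ.* ((1 ℕ.+ 3 ℕ.* k) ℕ.* (2 ℕ.+ 3 ℕ.* k)) ℕ.* c)
          ≡⟨ pos-*-* 3 ((1 ℕ.+ 3 ℕ.* k) ℕ.* (2 ℕ.+ 3 ℕ.* k)) c ⟩
        + 3 * + ((1 ℕ.+ 3 ℕ.* k) ℕ.* (2 ℕ.+ 3 ℕ.* k)) * + c
          ≡⟨ cong (λ x → + 3 * x * + c) (ℤ.pos-* (1 ℕ.+ 3 ℕ.* k) (2 ℕ.+ 3 ℕ.* k)) ⟩
        + 3 * ((+ 1 + + (3 ℕ.* k)) * (+ 2 + + (3 ℕ.* k))) * + c
          ≡⟨ cong (λ x → + 3 * ((+ 1 + x) * (+ 2 + x)) * + c) (ℤ.pos-* 3 k) ⟩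
        + 3 * ((+ 1 + + 3 * + k) * (+ 2 + + 3 * + k)) * + c ∎
      Md′ : M * + d′ ≡ (+ 1 + + n + + k) * + j * + d
      Md′ = begin
        M * + d′
          ≡⟨ pos-*-* (1 ℕ.+ 2 ℕ.* k) (2 ℕ.+ 2 ℕ.* k) d′ ⟨
        + ((1 ℕ.+ 2 ℕ.* k) ℕ.* (2 ℕ.+ 2 ℕ.* k) ℕ.* d′)
          ≡⟨ cong +_ (subst (λ n → (1 ℕ.+ 2 ℕ.* k) ℕ.* (2 ℕ.+ 2 ℕ.* k) ℕ.* ((n ℕ.+ suc k) C (2 ℕ.* suc k))
                                   ≡ (1 ℕ.+ n ℕ.+ k) ℕ.* j ℕ.* ((n ℕ.+ k) C (2 ℕ.* k)))
                            k+j≡n ([n+k]C[2k]-suc k j)) ⟩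
        + ((1 ℕ.+ n ℕ.+ k) ℕ.* j ℕ.* d)
          ≡⟨ pos-*-* (1 ℕ.+ n ℕ.+ k) j d ⟩
        (+ 1 + + n + + k) * + j * + d ∎
      distribute : ∀ M c d e w → M * (c - -1ℤ * e * d * (+ 27 * w)) ≡ M * c + + 27 * (e * w) * (M * d)
      distribute = solve-∀
      -- (3k+1)(3k+2) + 9(n+k+1)(n-k) = (3n+1)(3n+2)
      regroup : ∀ K J c d e w →
        + 3 * ((+ 1 + + 3 * K) * (+ 2 + + 3 * K)) * c + + 27 * (e * w) * ((+ 1 + (K + J) + K) * J * d)
        ≡ + 3 * ((+ 1 + + 3 * K) * (+ 2 + + 3 * K)) * (c - e * d * w)
          + + 3 * (e * w) * d * ((+ 1 + + 3 * (K + J)) * (+ 2 + + 3 * (K + J)))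
      regroup = solve-∀
      N≡ : + k + + j ≡ + n
      N≡ = cong +_ k+j≡n
      eq : M * (+ c′ - β n (suc k) * + (27 ℕ.^ suc k))
         ≡ + 3 * ((+ 1 + + 3 * + k) * (+ 2 + + 3 * + k)) * (+ c - β n k * + w)
           + + 3 * (e * + w) * + d * ((+ 1 + + 3 * + n) * (+ 2 + + 3 * + n))
      eq = begin
        M * (+ c′ - β n (suc k) * + (27 ℕ.^ suc k))
          ≡⟨ cong (λ x → M * (+ c′ - β n (suc k) * x)) (ℤ.pos-* 27 w) ⟩
        M * (+ c′ - -1ℤ * e * + d′ * (+ 27 * + w))
          ≡⟨ distribute M (+ c′) (+ d′) e (+ w) ⟩
        M * + c′ + + 27 * (e * + w) * (M * + d′)
          ≡⟨ cong₂ (λ x y → x + + 27 * (e * + w) * y) Mc′ Md′ ⟩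
        + 3 * ((+ 1 + + 3 * + k) * (+ 2 + + 3 * + k)) * + c + + 27 * (e * + w) * ((+ 1 + + n + + k) * + j * + d)
          -- The ring identity treats n - k as a free variable `J` and writes n as `K + J`; `N≡`
          -- then restores `n`.
          ≡⟨ subst (λ N → + 3 * ((+ 1 + + 3 * + k) * (+ 2 + + 3 * + k)) * + c
                            + + 27 * (e * + w) * ((+ 1 + N + + k) * + j * + d)
                        ≡ + 3 * ((+ 1 + + 3 * + k) * (+ 2 + + 3 * + k)) * (+ c - β n k * + w)
                            + + 3 * (e * + w) * + d * ((+ 1 + + 3 * N) * (+ 2 + + 3 * N)))
                   N≡ (regroup (+ k) (+ j) (+ c) (+ d) e (+ w)) ⟩
        _ ∎

    term-∼ : ∀ k → k ≤ n → term k ∼ β n k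
    term-∼ k k≤n = /-∼ (+ ((3 ℕ.* k) C k)) (27 ℕ.^ k) {{ℕ.m^n≢0 27 k}} (β n k) (p∤27^ k) ([3k]Ck≡27^k*β k k≤n)

    S-∼ : ∀ m → m ≤ n → S m ∼ Σ≤ (β n) m
    S-∼ zero    m≤n = term-∼ zero m≤n
    S-∼ (suc m) m<n = +-∼ (S m) (term (suc m)) (Σ≤ (β n) m) (β n (suc m))
      (S-∼ m (ℕ.<⇒≤ m<n)) (term-∼ (suc m) m<n)

    S[p/3]≡ : ∀ r → b (p % 18 / 3) ≡ r → S n ≡ r [modℚ p ]
    S[p/3]≡ r b≡r = ∼⇒≡mod (S n) r (subst (S n ∼_) (trans (b-[p/3] p) b≡r) (S-∼ n ℕ.≤-refl))

    p-odd : p % 2 ≢ 0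
    p-odd e = small∤ (λ ()) (ℕ.<-trans (ℕ.n<1+n 2) p>3) (ℕ.m%n≡0⇒n∣m p 2 e)

theorem3p2 : (p : ℕ) → Prime p → p > 3 →
    ((p % 9 ≡ 1 ⊎ p % 9 ≡ 8) → S (p / 3) ≡ + 1 [modℚ p ])
    × ((p % 9 ≡ 2 ⊎ p % 9 ≡ 7) → S (p / 3) ≡ - (+ 1) [modℚ p ])
    × ((p % 9 ≡ 4 ⊎ p % 9 ≡ 5) → S (p / 3) ≡ + 0 [modℚ p ])
theorem3p2 p p-prime p>3 =
  S[p/3]≡ p-prime p>3 (+ 1) ∘ proj₁ table ,
  S[p/3]≡ p-prime p>3 (- (+ 1)) ∘ proj₁ (proj₂ table) ,
  S[p/3]≡ p-prime p>3 (+ 0) ∘ proj₂ (proj₂ table)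
  where
  table : Table (p % 18) (p % 9)
  -- As 9 and 2 both divide 18, the residue of `p` modulo 18 keeps its class modulo 9 and its
  -- parity.
  table = subst (Table (p % 18)) (ℕ.m∣n⇒o%n%m≡o%m 9 18 p (ℕ.divides 2 refl))
    (b-table (ℕ.m%n<n p 18)
      (p-odd p-prime p>3 ∘ trans (sym (ℕ.m∣n⇒o%n%m≡o%m 2 18 p (ℕ.divides 9 refl)))))
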